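{- For every integer $d\ge 0$, there exists $\varepsilon>0$ such that for every $d$-degenerate graph $G$ and every list assignment $L$ for $G$ with $|L(v)|=d+2$ for all $v\in V(G)$, the graph $G$ with the list assignment $L$ is weighted $\varepsilon$-flexible.
   Context: Graphs are finite and simple. A graph $G$ is $d$-degenerate if every (non-null) subgraph of $G$ has a vertex of degree at most $d$. A list assignment $L$ for $G$ assigns to each vertex $v\in V(G)$ a finite set $L(v)$ of colors; an $L$-coloring is a proper coloring $\phi$ of $G$ with $\phi(v)\in L(v)$ for all $v\in V(G)$. A weighted request for $G$ with $L$ is a function $w$ that assigns to each pair $(v,c)$ with $v\in V(G)$, $c\in L(v)$ a nonnegative real number $w(v,c)$. Let $w(G,L)=\sum_{v\in V(G),\,c\in L(v)} w(v,c)$. For $\varepsilon>0$, $w$ is $\varepsilon$-satisfiable if there exists an $L$-coloring $\phi$ of $G$ such that $\sum_{v\in V(G)} w(v,\phi(v))\ge\varepsilon\, w(G,L)$. $G$ with $L$ is weighted $\varepsilon$-flexible if every weighted request is $\varepsilon$-satisfiable. -}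

module Defs where

open import Data.Fin using (Fin)
open import Data.Fin.Subset using (Subset; Nonempty) renaming (_∈_ to _∈ₛ_)
open import Data.List using (List; allFin; filter; foldr; length; map)
open import Data.List.Membership.Propositional using (_∈_; mapWith∈)
open import Data.List.Relation.Unary.Unique.Propositional using (Unique)
open import Data.Nat as ℕ using (ℕ)
import Data.Nat.Properties as ℕ
open import Data.Product using (∃; _×_; _,_)
open import Data.Rational as ℚ using (ℚ; 0ℚ; 1ℚ; ½; ∣_∣; 1/_)
import Data.Rational.Properties as ℚ
open import Data.Rational.Solver using (module +-*-Solver)
open import Level using (0ℓ)
open import Relation.Binary using (Rel; Decidable; Symmetric)
open import Relation.Binary.PropositionalEquality
  using (_≡_; _≢_; refl; sym; trans; cong; cong₂; subst)
open import Relation.Nullary using (¬_)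

------------------------------------------------------------------------
-- Real numbers: Cauchy sequences of rationals.  Two sequences denote the
-- same real when x ≤ y and y ≤ x; the order and the operations below
-- respect this.

IsCauchy : (ℕ → ℚ) → Set
IsCauchy x = ∀ η → 0ℚ ℚ.< η →
  ∃ λ N → ∀ m n → N ℕ.≤ m → N ℕ.≤ n → ∣ x m ℚ.- x n ∣ ℚ.≤ η

record ℝ : Set where
  constructor mkℝ
  field
    seq    : ℕ → ℚ
    cauchy : IsCauchy seq

open ℝ public

infix 4 _≤_ _<_ _≥_

_≤_ : ℝ → ℝ → Set
x ≤ y = ∀ η → 0ℚ ℚ.< η →
  ∃ λ N → ∀ n → N ℕ.≤ n → seq x n ℚ.≤ seq y n ℚ.+ η

_≥_ : ℝ → ℝ → Set
x ≥ y = y ≤ x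

_<_ : ℝ → ℝ → Set
x < y = ∃ λ η → 0ℚ ℚ.< η ×
  ∃ λ N → ∀ n → N ℕ.≤ n → seq x n ℚ.+ η ℚ.≤ seq y n

private
  half+half : ∀ η → η ℚ.* ½ ℚ.+ η ℚ.* ½ ≡ η
  half+half η = trans (sym (ℚ.*-distribˡ-+ η ½ ½)) (ℚ.*-identityʳ η)

  *-pos : ∀ {p q} → 0ℚ ℚ.< p → 0ℚ ℚ.< q → 0ℚ ℚ.< p ℚ.* q
  *-pos {p} {q} 0<p 0<q =
    ℚ.positive⁻¹ (p ℚ.* q)
      {{ℚ.pos*pos⇒pos p {{ℚ.positive 0<p}} q {{ℚ.positive 0<q}}}}

  half-pos : ∀ {η} → 0ℚ ℚ.< η → 0ℚ ℚ.< η ℚ.* ½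
  half-pos 0<η = *-pos 0<η (ℚ.positive⁻¹ ½)

  *-mono-≤ : ∀ {p q r s} → 0ℚ ℚ.≤ r → 0ℚ ℚ.≤ q →
             p ℚ.≤ q → r ℚ.≤ s → p ℚ.* r ℚ.≤ q ℚ.* s
  *-mono-≤ {p} {q} {r} {s} 0≤r 0≤q p≤q r≤s = ℚ.≤-trans
    (ℚ.*-monoʳ-≤-nonNeg r {{ℚ.nonNegative 0≤r}} p≤q)
    (ℚ.*-monoˡ-≤-nonNeg q {{ℚ.nonNegative 0≤q}} r≤s)

  eventually-bounded : ∀ {x} → IsCauchy x →
    ∃ λ B → 0ℚ ℚ.< B × ∃ λ N → ∀ n → N ℕ.≤ n → ∣ x n ∣ ℚ.≤ B
  eventually-bounded {x} cx with cx 1ℚ (ℚ.positive⁻¹ 1ℚ)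
  ... | N , close =
    1ℚ ℚ.+ ∣ x N ∣ ,
    ℚ.+-mono-<-≤ (ℚ.positive⁻¹ 1ℚ) (ℚ.0≤∣p∣ (x N)) ,
    N , λ n N≤n → begin
      ∣ x n ∣                          ≡⟨ cong ∣_∣ (split (x n) (x N)) ⟩
      ∣ (x n ℚ.- x N) ℚ.+ x N ∣        ≤⟨ ℚ.∣p+q∣≤∣p∣+∣q∣ (x n ℚ.- x N) (x N) ⟩
      ∣ x n ℚ.- x N ∣ ℚ.+ ∣ x N ∣      ≤⟨ ℚ.+-monoˡ-≤ ∣ x N ∣ (close n N N≤n ℕ.≤-refl) ⟩
      1ℚ ℚ.+ ∣ x N ∣                   ∎
    where
    open ℚ.≤-Reasoning
    split : ∀ a b → a ≡ (a ℚ.- b) ℚ.+ b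
    split = solve 2 (λ a b → a := (a :- b) :+ b) refl
      where open +-*-Solver

  +-cauchy : ∀ {x y} → IsCauchy x → IsCauchy y → IsCauchy (λ n → x n ℚ.+ y n)
  +-cauchy {x} {y} cx cy η 0<η
    with cx (η ℚ.* ½) (half-pos 0<η) | cy (η ℚ.* ½) (half-pos 0<η)
  ... | M , closeˣ | N , closeʸ = M ℕ.⊔ N , λ m n ≤m ≤n → begin
    ∣ (x m ℚ.+ y m) ℚ.- (x n ℚ.+ y n) ∣
      ≡⟨ cong ∣_∣ (split (x m) (y m) (x n) (y n)) ⟩
    ∣ (x m ℚ.- x n) ℚ.+ (y m ℚ.- y n) ∣
      ≤⟨ ℚ.∣p+q∣≤∣p∣+∣q∣ (x m ℚ.- x n) (y m ℚ.- y n) ⟩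
    ∣ x m ℚ.- x n ∣ ℚ.+ ∣ y m ℚ.- y n ∣
      ≤⟨ ℚ.+-mono-≤ (closeˣ m n (ℕ.m⊔n≤o⇒m≤o M N ≤m) (ℕ.m⊔n≤o⇒m≤o M N ≤n))
                    (closeʸ m n (ℕ.m⊔n≤o⇒n≤o M N ≤m) (ℕ.m⊔n≤o⇒n≤o M N ≤n)) ⟩
    η ℚ.* ½ ℚ.+ η ℚ.* ½
      ≡⟨ half+half η ⟩
    η ∎
    where
    open ℚ.≤-Reasoning
    split : ∀ a b c d → (a ℚ.+ b) ℚ.- (c ℚ.+ d) ≡ (a ℚ.- c) ℚ.+ (b ℚ.- d)
    split = solve 4 (λ a b c d → (a :+ b) :- (c :+ d) := (a :- c) :+ (b :- d)) refl
      where open +-*-Solver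

  divide : ∀ {C η} → 0ℚ ℚ.< C → 0ℚ ℚ.< η → ∃ λ e → 0ℚ ℚ.< e × C ℚ.* e ≡ η
  divide {C} {η} 0<C 0<η =
    1/ C ℚ.* η ,
    *-pos (ℚ.positive⁻¹ (1/ C) {{ℚ.1/pos⇒pos C}}) 0<η ,
    trans (sym (ℚ.*-assoc C (1/ C) η))
      (trans (cong (ℚ._* η) (ℚ.*-inverseʳ C)) (ℚ.*-identityˡ η))
    where
    instance
      C-pos : ℚ.Positive C
      C-pos = ℚ.positive 0<C
      C-nz : ℚ.NonZero C
      C-nz = ℚ.pos⇒nonZero C

  product-close : ∀ {A B e f} a b c d → 0ℚ ℚ.< A → 0ℚ ℚ.< B →
    ∣ a ∣ ℚ.≤ A → ∣ d ∣ ℚ.≤ B → ∣ b ℚ.- d ∣ ℚ.≤ e → ∣ a ℚ.- c ∣ ℚ.≤ f →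
    ∣ (a ℚ.* b) ℚ.- (c ℚ.* d) ∣ ℚ.≤ A ℚ.* e ℚ.+ B ℚ.* f
  product-close {A} {B} {e} {f} a b c d 0<A 0<B a≤A d≤B b-d≤e a-c≤f = begin
    ∣ (a ℚ.* b) ℚ.- (c ℚ.* d) ∣
      ≡⟨ cong ∣_∣ (split a b c d) ⟩
    ∣ a ℚ.* (b ℚ.- d) ℚ.+ d ℚ.* (a ℚ.- c) ∣
      ≤⟨ ℚ.∣p+q∣≤∣p∣+∣q∣ (a ℚ.* (b ℚ.- d)) (d ℚ.* (a ℚ.- c)) ⟩
    ∣ a ℚ.* (b ℚ.- d) ∣ ℚ.+ ∣ d ℚ.* (a ℚ.- c) ∣
      ≤⟨ ℚ.+-mono-≤ (bound a (b ℚ.- d) 0<A a≤A b-d≤e)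
                    (bound d (a ℚ.- c) 0<B d≤B a-c≤f) ⟩
    A ℚ.* e ℚ.+ B ℚ.* f ∎
    where
    open ℚ.≤-Reasoning
    split : ∀ a b c d →
      (a ℚ.* b) ℚ.- (c ℚ.* d) ≡ a ℚ.* (b ℚ.- d) ℚ.+ d ℚ.* (a ℚ.- c)
    split = solve 4 (λ a b c d →
      (a :* b) :- (c :* d) := a :* (b :- d) :+ d :* (a :- c)) refl
      where open +-*-Solver
    bound : ∀ {C e} p q → 0ℚ ℚ.< C → ∣ p ∣ ℚ.≤ C → ∣ q ∣ ℚ.≤ e →
            ∣ p ℚ.* q ∣ ℚ.≤ C ℚ.* e
    bound {C} {e} p q 0<C p≤C q≤e =
      subst (ℚ._≤ C ℚ.* e) (sym (ℚ.∣p*q∣≡∣p∣*∣q∣ p q))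
        (*-mono-≤ (ℚ.0≤∣p∣ q) (ℚ.<⇒≤ 0<C) p≤C q≤e)

  *-cauchy : ∀ {x y} → IsCauchy x → IsCauchy y → IsCauchy (λ n → x n ℚ.* y n)
  *-cauchy {x} {y} cx cy η 0<η =
    choose-bounds (eventually-bounded cx) (eventually-bounded cy)
    where
    Close : (ℕ → ℚ) → ℚ → Set
    Close z e = ∃ λ N → ∀ m n → N ℕ.≤ m → N ℕ.≤ n → ∣ z m ℚ.- z n ∣ ℚ.≤ e

    Bounded : (ℕ → ℚ) → ℚ → Set
    Bounded z B = ∃ λ N → ∀ n → N ℕ.≤ n → ∣ z n ∣ ℚ.≤ B

    combine : ∀ {A B e f} → 0ℚ ℚ.< A → 0ℚ ℚ.< B → A ℚ.* e ℚ.+ B ℚ.* f ≡ η →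
      Bounded x A → Bounded y B → Close y e → Close x f →
      Close (λ n → x n ℚ.* y n) η
    combine 0<A 0<B eq (K , boundˣ) (L , boundʸ) (M , closeʸ) (N , closeˣ) =
      (K ℕ.⊔ L) ℕ.⊔ (M ℕ.⊔ N) , λ m n ≤m ≤n →
      let KL≤m = ℕ.m⊔n≤o⇒m≤o (K ℕ.⊔ L) (M ℕ.⊔ N) ≤m
          MN≤m = ℕ.m⊔n≤o⇒n≤o (K ℕ.⊔ L) (M ℕ.⊔ N) ≤m
          KL≤n = ℕ.m⊔n≤o⇒m≤o (K ℕ.⊔ L) (M ℕ.⊔ N) ≤n
          MN≤n = ℕ.m⊔n≤o⇒n≤o (K ℕ.⊔ L) (M ℕ.⊔ N) ≤n
      in subst (∣ (x m ℚ.* y m) ℚ.- (x n ℚ.* y n) ∣ ℚ.≤_) eq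
           (product-close (x m) (y m) (x n) (y n) 0<A 0<B
             (boundˣ m (ℕ.m⊔n≤o⇒m≤o K L KL≤m))
             (boundʸ n (ℕ.m⊔n≤o⇒n≤o K L KL≤n))
             (closeʸ m n (ℕ.m⊔n≤o⇒m≤o M N MN≤m) (ℕ.m⊔n≤o⇒m≤o M N MN≤n))
             (closeˣ m n (ℕ.m⊔n≤o⇒n≤o M N MN≤m) (ℕ.m⊔n≤o⇒n≤o M N MN≤n)))

    choose-tolerances : ∀ {A B} → 0ℚ ℚ.< A → 0ℚ ℚ.< B → Bounded x A → Bounded y B →
      (∃ λ e → 0ℚ ℚ.< e × A ℚ.* e ≡ η ℚ.* ½) →
      (∃ λ f → 0ℚ ℚ.< f × B ℚ.* f ≡ η ℚ.* ½) →
      Close (λ n → x n ℚ.* y n) η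
    choose-tolerances 0<A 0<B bˣ bʸ (e , 0<e , Ae≡η/2) (f , 0<f , Bf≡η/2) =
      combine 0<A 0<B (trans (cong₂ ℚ._+_ Ae≡η/2 Bf≡η/2) (half+half η))
        bˣ bʸ (cy e 0<e) (cx f 0<f)

    choose-bounds :
      (∃ λ A → 0ℚ ℚ.< A × Bounded x A) → (∃ λ B → 0ℚ ℚ.< B × Bounded y B) →
      Close (λ n → x n ℚ.* y n) η
    choose-bounds (A , 0<A , bˣ) (B , 0<B , bʸ) =
      choose-tolerances 0<A 0<B bˣ bʸ
        (divide 0<A (half-pos 0<η)) (divide 0<B (half-pos 0<η))

fromℚ : ℚ → ℝ
fromℚ q = mkℝ (λ _ → q) λ η 0<η →
  0 , λ _ _ _ _ → subst (λ p → ∣ p ∣ ℚ.≤ η) (sym (ℚ.+-inverseʳ q)) (ℚ.<⇒≤ 0<η)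

0ℝ : ℝ
0ℝ = fromℚ 0ℚ

infixl 6 _+_
infixl 7 _*_

_+_ : ℝ → ℝ → ℝ
x + y = mkℝ (λ n → seq x n ℚ.+ seq y n) (+-cauchy {seq x} {seq y} (cauchy x) (cauchy y))

_*_ : ℝ → ℝ → ℝ
x * y = mkℝ (λ n → seq x n ℚ.* seq y n) (*-cauchy {seq x} {seq y} (cauchy x) (cauchy y))

sum : List ℝ → ℝ
sum = foldr _+_ 0ℝ

------------------------------------------------------------------------
-- Finite simple graphs

record Graph : Set₁ where
  field
    order    : ℕ
    _~_      : Rel (Fin order) 0ℓ
    _~?_     : Decidable _~_
    ~-sym    : Symmetric _~_
    ~-irrefl : ∀ v → ¬ (v ~ v)

  V : Set
  V = Fin order

-- Subgraphs need not be induced.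
record Subgraph (G : Graph) : Set₁ where
  open Graph G
  field
    vertices : Subset order
    _~ₛ_     : Rel V 0ℓ
    _~ₛ?_    : Decidable _~ₛ_
    ~ₛ-sym   : Symmetric _~ₛ_
    ~ₛ⇒~     : ∀ {u v} → u ~ₛ v → u ~ v
    ~ₛ⇒∈     : ∀ {u v} → u ~ₛ v → u ∈ₛ vertices

  degree : V → ℕ
  degree v = length (filter (v ~ₛ?_) (allFin order))

Degenerate : ℕ → Graph → Set₁
Degenerate d G = (H : Subgraph G) → let open Subgraph H in
  Nonempty vertices → ∃ λ v → v ∈ₛ vertices × degree v ℕ.≤ d

------------------------------------------------------------------------
-- List colouring and weighted requests

-- The finite set L(v) is a duplicate-free list, so its size is the length.
record ListAssignment (G : Graph) (C : Set) : Set where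
  open Graph G
  field
    colors : V → List C
    unique : ∀ v → Unique (colors v)

module _ {G : Graph} {C : Set} (L : ListAssignment G C) where
  open Graph G
  open ListAssignment L

  record Coloring : Set where
    field
      color  : V → C
      proper : ∀ {u v} → u ~ v → color u ≢ color v
      listed : ∀ v → color v ∈ colors v

  record WeightedRequest : Set where
    field
      weight : ∀ v {c} → c ∈ colors v → ℝ
      nonneg : ∀ v {c} (c∈ : c ∈ colors v) → weight v c∈ ≥ 0ℝ

  totalWeight : WeightedRequest → ℝ
  totalWeight w = sum (map (λ v → sum (mapWith∈ (colors v) (weight v))) (allFin order))
    where open WeightedRequest w

  coloringWeight : WeightedRequest → Coloring → ℝ
  coloringWeight w φ = sum (map (λ v → weight v (listed v)) (allFin order))
    where open WeightedRequest w; open Coloring φ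

  Satisfiable : ℝ → WeightedRequest → Set
  Satisfiable ε w = ∃ λ φ → coloringWeight w φ ≥ ε * totalWeight w

  WeightedFlexible : ℝ → Set
  WeightedFlexible ε = ∀ w → Satisfiable ε w

{-# OPTIONS --safe #-}
module Submission where

-- Colour the vertices one at a time so that each has at most d coloured
-- neighbours when its turn comes: at least two of its d + 2 colours are still
-- free.  Pick one of the d + 2 colours uniformly at random, and replace it by a
-- fixed free colour if it is not free.  Every free colour then has probability
-- at least 1 / (d + 2).  A given colour c of v is used at a given neighbour of v
-- with conditional probability at most 1 - 1 / (d + 2), because some other
-- colour is free there.  Hence c is free at v with probability at least
-- (d + 2) ^ - d, and v gets it with probability at least
-- ε = (d + 2) ^ - (d + 1).  So the expected weight is at least ε times the
-- total weight, and some outcome reaches the expectation.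

open import Defs
open import Algebra.Bundles using (CommutativeRing; Semiring)
open import Axiom.ExcludedMiddle using (ExcludedMiddle)
open import Data.Bool using (if_then_else_)
open import Data.Fin as Fin using (Fin; zero; suc; cast)
import Data.Fin.Properties as Fin
open import Data.Fin.Subset using (Subset; _-_; ∣_∣; ⊤; ⁅_⁆) renaming (_∈_ to _∈ₛ_; _∉_ to _∉ₛ_)
import Data.Fin.Subset.Properties as Subset
open import Data.List
  using (List; []; _∷_; allFin; concatMap; filter; length; lookup; map; tabulate)
open import Data.List.Properties
  using (filter-++; filter-all; filter-some; length-++; length-tabulate; map-tabulate)
open import Data.List.Membership.Propositional using (_∈_; _∉_; find; lose; mapWith∈)
open import Data.List.Membership.Propositional.Properties
  using (∈-allFin; ∈-concatMap⁻; ∈-filter⁺; ∈-filter⁻; ∈-lookup; ∈-tabulate⁻)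
import Data.List.Membership.Setoid.Properties as Membership
open import Data.List.Relation.Binary.Subset.Propositional using (_⊆_)
open import Data.List.Relation.Unary.All as All using (All; []; _∷_)
import Data.List.Relation.Unary.All.Properties as All
open import Data.List.Relation.Unary.AllPairs using ([]; _∷_)
open import Data.List.Relation.Unary.Any as Any using (Any; here; there)
import Data.List.Relation.Unary.Any.Properties as Any
open import Data.List.Relation.Unary.Unique.Propositional using (Unique)
import Data.List.Relation.Unary.Unique.Propositional.Properties as Unique
open import Data.Nat as ℕ using (ℕ; zero; suc; s≤s; z≤n)
import Data.Nat.Properties as ℕ
open import Data.Product using (∃; _×_; _,_; proj₁; proj₂)
open import Data.Rational as ℚ using (ℚ; 0ℚ; 1ℚ; ½; 1/_)
import Data.Rational.Properties as ℚ
open import Data.Rational.Solver using (module +-*-Solver)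
open import Data.Sum using (_⊎_; inj₁; inj₂; [_,_])
open import Data.Vec.Functional using (updateAt)
open import Data.Vec.Functional.Properties using (updateAt-updates; updateAt-minimal)
open import Function using (const; id; _∘_)
open import Level using (0ℓ)
open import Relation.Binary using (Rel; Decidable)
open import Relation.Binary.PropositionalEquality
  using (_≡_; _≢_; refl; sym; trans; cong; cong₂; subst; setoid; module ≡-Reasoning)
open import Relation.Nullary using (¬_; Dec; yes; no; does; ¬?; _×-dec_; contradiction)
import Relation.Unary as Unary

ℚ-semiring : Semiring 0ℓ 0ℓ
ℚ-semiring = CommutativeRing.semiring ℚ.+-*-commutativeRing

open import Algebra.Properties.Semiring.Sum ℚ-semiring
  using (∑-distrib-+; ∑-comm; sum-replicate; sum-replicate-zero; sum-cong-≗)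
  renaming (sum to ∑)
open import Algebra.Properties.Semiring.Mult ℚ-semiring
  using (×-assocˡ; ×-comm-*; ×-assoc-*)
  renaming (_×_ to _·_)

-- Counting in lists

count : {A : Set} {P : A → Set} → Unary.Decidable P → List A → ℕ
count P? xs = length (filter P? xs)

-- One stage of the random process replaces an outcome `x` by the block `g x`; the blocks of entries
-- with `P` alone already give this many entries with `Q`.
count-concatMap : {A B : Set} {P : A → Set} {Q : B → Set}
  (P? : Unary.Decidable P) (Q? : Unary.Decidable Q) {g : A → List B} (k : ℕ) →
  (∀ {x} → P x → k ℕ.≤ count Q? (g x)) →
  ∀ xs → k ℕ.* count P? xs ℕ.≤ count Q? (concatMap g xs)
count-concatMap P? Q? k k≤ [] = ℕ.≤-reflexive (ℕ.*-zeroʳ k)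
count-concatMap P? Q? {g} k k≤ (x ∷ xs)
  rewrite filter-++ Q? (g x) (concatMap g xs)
        | length-++ (filter Q? (g x)) {filter Q? (concatMap g xs)}
  with P? x
... | yes px = subst (ℕ._≤ count Q? (g x) ℕ.+ count Q? (concatMap g xs)) (sym (ℕ.*-suc k (count P? xs)))
                 (ℕ.+-mono-≤ (k≤ px) (count-concatMap P? Q? {g} k k≤ xs))
... | no  _  = ℕ.m≤n⇒m≤o+n (count Q? (g x)) (count-concatMap P? Q? {g} k k≤ xs)

length-concatMap : {A B : Set} {g : A → List B} {k : ℕ} →
  (∀ x → length (g x) ≡ k) → ∀ xs → length (concatMap g xs) ≡ k ℕ.* length xs
length-concatMap {k = k} eq [] = sym (ℕ.*-zeroʳ k)
length-concatMap {g = g} {k} eq (x ∷ xs) = trans (length-++ (g x))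
  (trans (cong₂ ℕ._+_ (eq x) (length-concatMap eq xs)) (sym (ℕ.*-suc k (length xs))))

lookup-injective : {A : Set} {xs : List A} → Unique xs →
  ∀ i j → lookup xs i ≡ lookup xs j → i ≡ j
lookup-injective (_  ∷ _)  zero    zero    _  = refl
lookup-injective (x∉ ∷ _)  zero    (suc j) eq = contradiction eq (All.lookup x∉ (∈-lookup j))
lookup-injective (x∉ ∷ _)  (suc i) zero    eq = contradiction (sym eq) (All.lookup x∉ (∈-lookup i))
lookup-injective (_  ∷ xs) (suc i) (suc j) eq = cong suc (lookup-injective xs i j eq)

Unique-⊆⇒length≤ : {A : Set} {xs ys : List A} → Unique xs → xs ⊆ ys → length xs ℕ.≤ length ys
Unique-⊆⇒length≤ {A} {xs} unique xs⊆ys =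
  Fin.injective⇒≤ {f = λ i → Any.index (xs⊆ys (∈-lookup i))} λ {i} {j} eq →
    lookup-injective unique i j
      (Membership.index-injective (setoid A) (xs⊆ys (∈-lookup i)) (xs⊆ys (∈-lookup j)) eq)

-- Degeneracy orderings

module _ {n : ℕ} {_~_ : Rel (Fin n) 0ℓ} (_~?_ : Decidable _~_) (d : ℕ) where

  -- The head of the list is the last vertex to be coloured.
  data Ordering : List (Fin n) → Set where
    []  : Ordering []
    add : ∀ {v vs} → v ∉ vs → count (v ~?_) vs ℕ.≤ d → Ordering vs → Ordering (v ∷ vs)

  ordering-unique : ∀ {vs} → Ordering vs → Unique vs
  ordering-unique []           = []
  ordering-unique (add v∉ _ o) = All.¬Any⇒All¬ _ v∉ ∷ ordering-unique o

-- Removing `x` a second time changes nothing, whereas removing a member would make the subset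
-- strictly smaller.
x∉p-x : ∀ {n} (p : Subset n) x → x ∉ₛ p - x
x∉p-x p x x∈ = ℕ.<-irrefl (cong ∣_∣ (Subset.p─q─q≡p─q p ⁅ x ⁆))
  (Subset.x∈p⇒∣p-x∣<∣p∣ x∈)

module _ (G : Graph) where
  open Graph G

  induced : Subset order → Subgraph G
  induced S = record
    { vertices = S
    ; _~ₛ_     = λ u v → u ∈ₛ S × v ∈ₛ S × u ~ v
    ; _~ₛ?_    = λ u v → (u Subset.∈? S) ×-dec (v Subset.∈? S) ×-dec (u ~? v)
    ; ~ₛ-sym   = λ (u∈ , v∈ , u~v) → v∈ , u∈ , ~-sym u~v
    ; ~ₛ⇒~     = λ (_ , _ , u~v) → u~v
    ; ~ₛ⇒∈     = λ (u∈ , _ , _) → u∈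
    }

  -- Take a vertex of degree at most `d` in the subgraph induced by the remaining vertices, order
  -- the others recursively, and colour this vertex after all of them.
  ordering : ∀ {d} → Degenerate d G → ∃ λ vs → Ordering _~?_ d vs × (∀ v → v ∈ vs)
  ordering {d} degenerate =
    let vs , o , S⊆ , _ = build (suc ∣ ⊤ {order} ∣) ⊤ ℕ.≤-refl in vs , o , λ v → S⊆ Subset.∈⊤
    where
    -- `m` exceeds the size of `S`, which makes the recursion structural. The inclusion of `vs` in
    -- `S` is carried along because it yields both `v ∉ vs` and the bound by `degree v` for the next
    -- vertex.
    build : ∀ m (S : Subset order) → ∣ S ∣ ℕ.< m →
            ∃ λ vs → Ordering _~?_ d vs × (∀ {v} → v ∈ₛ S → v ∈ vs) × (∀ {v} → v ∈ vs → v ∈ₛ S)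
    build zero    S ()
    build (suc m) S (s≤s ∣S∣≤m) with Subset.nonempty? S
    ... | no empty = [] , [] , (λ v∈S → contradiction (_ , v∈S) empty) , λ ()
    ... | yes nonempty
      with v , v∈S , deg≤d ← degenerate (induced S) nonempty
      with vs , o , to , from ← build m (S - v) (ℕ.<-≤-trans (Subset.x∈p⇒∣p-x∣<∣p∣ v∈S) ∣S∣≤m)
      = v ∷ vs , add (x∉p-x S v ∘ from) (ℕ.≤-trans deg≤ deg≤d) o , to′ , from′
      where
      open Subgraph (induced S)

      vs⊆S : ∀ {u} → u ∈ vs → u ∈ₛ S
      vs⊆S = Subset.p─q⊆p S _ ∘ from

      deg≤ : count (v ~?_) vs ℕ.≤ degree v
      deg≤ = Unique-⊆⇒length≤ (Unique.filter⁺ (v ~?_) (ordering-unique _~?_ d o)) λ u∈ →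
        let u∈vs , v~u = ∈-filter⁻ (v ~?_) u∈ in
        ∈-filter⁺ (v ~ₛ?_) (∈-allFin _) (v∈S , vs⊆S u∈vs , v~u)

      to′ : ∀ {u} → u ∈ₛ S → u ∈ v ∷ vs
      to′ {u} u∈S with u Fin.≟ v
      ... | yes u≡v = here u≡v
      ... | no  u≢v = there (to (Subset.x∈p∧x≢y⇒x∈p-y u∈S u≢v))

      from′ : ∀ {u} → u ∈ v ∷ vs → u ∈ₛ S
      from′ (here refl) = v∈S
      from′ (there u∈)  = vs⊆S u∈

-- Random greedy colouring

-- Colours are named by their position in the list, and Conflict v i u j says
-- that the i-th colour of v and the j-th colour of u exclude each other.
module Greedy
  {n d : ℕ} {_~_ : Rel (Fin n) 0ℓ} (_~?_ : Decidable _~_)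
  {Conflict : Fin n → Fin (2 ℕ.+ d) → Fin n → Fin (2 ℕ.+ d) → Set}
  (conflict?   : ∀ v i u j → Dec (Conflict v i u j))
  (adjacent    : ∀ {v i u j} → Conflict v i u j → v ~ u)
  (symmetric   : ∀ {v i u j} → Conflict v i u j → Conflict u j v i)
  (irreflexive : ∀ {v i j} → ¬ Conflict v i v j)
  (injective   : ∀ {v i u j j′} → Conflict v i u j → Conflict v i u j′ → j ≡ j′)
  where

  D : ℕ
  D = 2 ℕ.+ d

  Assignment : Set
  Assignment = Fin n → Fin D

  -- `v` need not be the next vertex to colour: `count-free` follows one position of a fixed vertex
  -- through all stages.
  Free : List (Fin n) → Fin n → Fin D → Assignment → Set
  Free vs v i φ = All (λ u → ¬ Conflict v i u (φ u)) vs

  free? : ∀ vs v i φ → Dec (Free vs v i φ)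
  free? vs v i φ = All.all? (λ u → ¬? (conflict? v i u (φ u))) vs

  _[_≔_] : Assignment → Fin n → Fin D → Assignment
  φ [ v ≔ j ] = updateAt φ v (const j)

  module _ {v : Fin n} {vs : List (Fin n)} (v∉vs : v ∉ vs) (deg≤d : count (v ~?_) vs ℕ.≤ d) where

    ≔-other : ∀ {φ j u} → u ∈ vs → (φ [ v ≔ j ]) u ≡ φ u
    ≔-other {φ} {j} {u} u∈ = updateAt-minimal u v φ λ { refl → v∉vs u∈ }

    -- Each of the at most d coloured neighbours rules out at most one of the
    -- d + 2 indices, so two are left.
    free-≢ : ∀ φ j → ∃ λ i → i ≢ j × Free vs v i φ
    free-≢ φ j with Fin.any? (λ i → ¬? (i Fin.≟ j) ×-dec free? vs v i φ)
    ... | yes found = found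
    ... | no  none =
      let i , i′ , i<i′ , eq = Fin.pigeonhole (s≤s (s≤s deg≤d)) (λ i → code i (i Fin.≟ j)) in
      contradiction (code-injective i i′ (i Fin.≟ j) (i′ Fin.≟ j) eq) (Fin.<⇒≢ i<i′)
      where
      blocker : ∀ i → i ≢ j → Any (λ u → Conflict v i u (φ u)) (filter (v ~?_) vs)
      blocker i i≢j with Any.any? (λ u → conflict? v i u (φ u)) vs
      ... | no  ¬any = contradiction (i , i≢j , All.¬Any⇒All¬ vs ¬any) none
      ... | yes any  with u , u∈ , c ← find any = lose (∈-filter⁺ (v ~?_) u∈ (adjacent c)) c

      -- `zero` is reserved for `j`, so there are at most `d + 1` codes for `d + 2` positions. Two
      -- positions with the same nonzero code are blocked by the same vertex, hence equal.
      code : ∀ i → Dec (i ≡ j) → Fin (suc (count (v ~?_) vs))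
      code i (yes _)   = zero
      code i (no  i≢j) = suc (Any.index (blocker i i≢j))

      code-injective : ∀ i i′ p q → code i p ≡ code i′ q → i ≡ i′
      code-injective i i′ (yes refl) (yes refl) _ = refl
      code-injective i i′ (no p) (no q) eq = injective
        (symmetric (Any.lookup-index (blocker i p)))
        (symmetric (subst (λ k → let u = lookup (filter (v ~?_) vs) k in Conflict v i′ u (φ u))
          (sym (Fin.suc-injective eq)) (Any.lookup-index (blocker i′ q))))

    choose : ∀ φ i → ∃ λ j → Free vs v j φ × (Free vs v i φ → j ≡ i)
    choose φ i with free? vs v i φ
    ... | yes free = i , free , const refl
    -- Any free substitute will do, so `zero` is an arbitrary position to avoid.
    ... | no ¬free with j , _ , free ← free-≢ φ zero = j , free , λ f → contradiction f ¬free

    extend : Assignment → Fin D → Assignment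
    extend φ i = φ [ v ≔ proj₁ (choose φ i) ]

    extensions : Assignment → List Assignment
    extensions φ = tabulate (extend φ)

    extend-free : ∀ {φ i} → Free vs v i φ → extend φ i v ≡ i
    extend-free {φ} {i} free = trans (updateAt-updates v φ) (proj₂ (proj₂ (choose φ i)) free)

    free-preserved : ∀ {x i φ} k → Free vs x i φ → Free vs x i (extend φ k)
    free-preserved {x} {i} k free = All.tabulate λ {u} u∈ →
      subst (λ j → ¬ Conflict x i u j) (sym (≔-other u∈)) (All.lookup free u∈)

    module _ {P : Assignment → Set} (P? : Unary.Decidable P) where

      all-extensions : ∀ {φ} → (∀ i → P (extend φ i)) → D ℕ.≤ count P? (extensions φ)
      all-extensions {φ} p = ℕ.≤-reflexive (sym (trans
        (cong length (filter-all P? (All.tabulate⁺ {f = extend φ} p))) (length-tabulate (extend φ))))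

      some-extension : ∀ {φ} i → P (extend φ i) → 1 ℕ.≤ count P? (extensions φ)
      some-extension i p = filter-some P? (Any.tabulate⁺ {f = extend _} i p)

    -- At most one position of `v` conflicts with position `i` of `x`, and `free-≢` finds a free one
    -- different from it. This keeps `i` alive at `x` when a neighbour of `x` is coloured.
    free-extension : ∀ {φ} x i → ∃ λ k → Free vs v k φ × ¬ Conflict x i v k
    free-extension {φ} x i with Fin.any? (λ k → conflict? x i v k)
    ... | no  none with k , _ , free ← free-≢ φ zero = k , free , λ c → none (k , c)
    ... | yes (j , cⱼ) with k , k≢j , free ← free-≢ φ j = k , free , λ c → k≢j (injective c cⱼ)

    free-∷ : ∀ {x i φ} k → Free vs x i φ → ¬ Conflict x i v (extend φ k v) →
             Free (v ∷ vs) x i (extend φ k)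
    free-∷ k free ¬c = ¬c ∷ free-preserved k free

  -- The equally likely outcomes; repetitions matter.
  outcomes : ∀ {vs} → Ordering _~?_ d vs → List Assignment
  -- An uncoloured vertex holds the default position `zero` until its turn; `Free` and `Proper`
  -- consult only the vertices in `vs`.
  outcomes []              = const zero ∷ []
  outcomes (add v∉ deg≤ o) = concatMap (extensions v∉ deg≤) (outcomes o)

  length-outcomes : ∀ {v vs} (v∉ : v ∉ vs) deg≤ (o : Ordering _~?_ d vs) →
    length (outcomes (add v∉ deg≤ o)) ≡ D ℕ.* length (outcomes o)
  length-outcomes v∉ deg≤ o =
    length-concatMap (λ φ → length-tabulate (extend v∉ deg≤ φ)) (outcomes o)

  outcomes-nonempty : ∀ {vs} (o : Ordering _~?_ d vs) → 0 ℕ.< length (outcomes o)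
  outcomes-nonempty []              = ℕ.z<s
  outcomes-nonempty (add v∉ deg≤ o) = subst (0 ℕ.<_) (sym (length-outcomes v∉ deg≤ o))
    (ℕ.<-≤-trans (outcomes-nonempty o) (ℕ.m≤m+n _ _))

  Proper : List (Fin n) → Assignment → Set
  Proper vs φ = ∀ {u w} → u ∈ vs → w ∈ vs → ¬ Conflict u (φ u) w (φ w)

  -- `choose` returns a position free with respect to `vs`, and the update at `v` leaves the
  -- positions on `vs` as they were.
  outcomes-proper : ∀ {vs} (o : Ordering _~?_ d vs) {φ} → φ ∈ outcomes o → Proper vs φ
  outcomes-proper (add {v} {vs} v∉ deg≤ o) φ∈
    with φ , φ∈ , e∈ ← find (∈-concatMap⁻ (extensions v∉ deg≤) {outcomes o} φ∈)
    with k , refl ← ∈-tabulate⁻ {f = extend v∉ deg≤ φ} e∈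
    = proper
    where
    v-free : ∀ {w} → w ∈ vs → ¬ Conflict v (extend v∉ deg≤ φ k v) w (extend v∉ deg≤ φ k w)
    v-free w∈ rewrite ≔-other v∉ deg≤ {φ} {proj₁ (choose v∉ deg≤ φ k)} w∈
                    | updateAt-updates v {const (proj₁ (choose v∉ deg≤ φ k))} φ
      = All.lookup (proj₁ (proj₂ (choose v∉ deg≤ φ k))) w∈

    proper : Proper (v ∷ vs) (extend v∉ deg≤ φ k)
    proper (here refl) (here refl) = irreflexive
    proper (here refl) (there w∈)  = v-free w∈
    proper (there u∈)  (here refl) = v-free u∈ ∘ symmetric
    proper (there u∈)  (there w∈)
      rewrite ≔-other v∉ deg≤ {φ} {proj₁ (choose v∉ deg≤ φ k)} u∈
            | ≔-other v∉ deg≤ {φ} {proj₁ (choose v∉ deg≤ φ k)} w∈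
      = outcomes-proper o φ∈ u∈ w∈

  -- Probability bounds as counts of outcomes

  private
    swap* : ∀ a b c → a ℕ.* (b ℕ.* c) ≡ b ℕ.* (a ℕ.* c)
    swap* a b c = trans (sym (ℕ.*-assoc a b c))
      (trans (cong (ℕ._* c) (ℕ.*-comm a b)) (ℕ.*-assoc b a c))

  module _ {v : Fin n} {vs : List (Fin n)} (v∉ : v ∉ vs) (deg≤ : count (v ~?_) vs ℕ.≤ d)
    (o : Ordering _~?_ d vs) {P Q : Assignment → Set} (P? : Unary.Decidable P) (Q? : Unary.Decidable Q)
    where
    open ℕ.≤-Reasoning

    -- The inequality says that the event has probability at least `1 / e`, without division. Here
    -- all `D` continuations of a good outcome are good, so nothing is lost.
    count-step : ∀ e →
      length (outcomes o) ℕ.≤ e ℕ.* count P? (outcomes o) →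
      (∀ {φ} → P φ → ∀ i → Q (extend v∉ deg≤ φ i)) →
      length (outcomes (add v∉ deg≤ o)) ℕ.≤ e ℕ.* count Q? (outcomes (add v∉ deg≤ o))
    count-step e ih step = begin
      length (outcomes (add v∉ deg≤ o))       ≡⟨ length-outcomes v∉ deg≤ o ⟩
      D ℕ.* length (outcomes o)               ≤⟨ ℕ.*-monoʳ-≤ D ih ⟩
      D ℕ.* (e ℕ.* count P? (outcomes o))     ≡⟨ swap* D e _ ⟩
      e ℕ.* (D ℕ.* count P? (outcomes o))     ≤⟨ ℕ.*-monoʳ-≤ e (count-concatMap P? Q? D
                                                   (all-extensions v∉ deg≤ Q? ∘ step) (outcomes o)) ⟩
      e ℕ.* count Q? (outcomes (add v∉ deg≤ o)) ∎

    -- Only one of the `D` equally likely continuations of a good outcome is known to be good, so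
    -- the bound worsens by the factor `D`.
    count-loss : ∀ e →
      length (outcomes o) ℕ.≤ e ℕ.* count P? (outcomes o) →
      (∀ {φ} → P φ → ∃ λ i → Q (extend v∉ deg≤ φ i)) →
      length (outcomes (add v∉ deg≤ o)) ℕ.≤ (D ℕ.* e) ℕ.* count Q? (outcomes (add v∉ deg≤ o))
    count-loss e ih step = begin
      length (outcomes (add v∉ deg≤ o))       ≡⟨ length-outcomes v∉ deg≤ o ⟩
      D ℕ.* length (outcomes o)               ≤⟨ ℕ.*-monoʳ-≤ D ih ⟩
      D ℕ.* (e ℕ.* count P? (outcomes o))     ≡⟨ ℕ.*-assoc D e _ ⟨
      D ℕ.* e ℕ.* count P? (outcomes o)       ≡⟨ cong (D ℕ.* e ℕ.*_) (ℕ.*-identityˡ _) ⟨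
      D ℕ.* e ℕ.* (1 ℕ.* count P? (outcomes o)) ≤⟨ ℕ.*-monoʳ-≤ (D ℕ.* e) (count-concatMap P? Q? 1
                                                   (λ p → let i , q = step p in
                                                          some-extension v∉ deg≤ Q? i q) (outcomes o)) ⟩
      D ℕ.* e ℕ.* count Q? (outcomes (add v∉ deg≤ o)) ∎

  -- Only a stage that colours a neighbour of `x` can spoil position `i`, and there `free-extension`
  -- provides a harmless continuation. Hence one factor `D` per coloured neighbour.
  count-free : ∀ {vs} (o : Ordering _~?_ d vs) x i →
    length (outcomes o) ℕ.≤ D ℕ.^ count (x ~?_) vs ℕ.* count (free? vs x i) (outcomes o)
  count-free [] x i = ℕ.≤-refl
  count-free (add {v} {vs} v∉ deg≤ o) x i with x ~? v
  ... | no x≁v = count-step v∉ deg≤ o (free? vs x i) (free? (v ∷ vs) x i)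
    (D ℕ.^ count (x ~?_) vs) (count-free o x i)
    λ free k → free-∷ v∉ deg≤ k free (x≁v ∘ adjacent)
  ... | yes _  = count-loss v∉ deg≤ o (free? vs x i) (free? (v ∷ vs) x i)
    (D ℕ.^ count (x ~?_) vs) (count-free o x i)
    λ free → let k , k-free , ¬c = free-extension v∉ deg≤ x i in
      k , free-∷ v∉ deg≤ k free (¬c ∘ subst (Conflict x i v) (extend-free v∉ deg≤ k-free))

  -- When `v` is coloured, `i` is free with probability at least `D ^ - d`, and then the
  -- continuation with index `i` picks it, which costs one more factor `D`. Later stages leave `v`
  -- unchanged.
  count-value : ∀ {vs} (o : Ordering _~?_ d vs) {v} → v ∈ vs → ∀ i →
    length (outcomes o) ℕ.≤ D ℕ.^ suc d ℕ.* count (λ φ → φ v Fin.≟ i) (outcomes o)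
  count-value (add {v} {vs} v∉ deg≤ o) (here refl) i =
    count-loss v∉ deg≤ o (free? vs v i) (λ φ → φ v Fin.≟ i) (D ℕ.^ d)
      (ℕ.≤-trans (count-free o v i) (ℕ.*-monoˡ-≤ _ (ℕ.^-monoʳ-≤ D deg≤)))
      λ free → i , extend-free v∉ deg≤ free
  count-value (add v∉ deg≤ o) {w} (there w∈) i =
    count-step v∉ deg≤ o (λ φ → φ w Fin.≟ i) (λ φ → φ w Fin.≟ i) (D ℕ.^ suc d) (count-value o w∈ i)
      λ eq k → trans (≔-other v∉ deg≤ w∈) eq

-- Finite sums of rationals

0≤· : ∀ m {x} → 0ℚ ℚ.≤ x → 0ℚ ℚ.≤ m · x
0≤· zero    0≤x = ℚ.≤-refl
0≤· (suc m) 0≤x = ℚ.+-mono-≤ 0≤x (0≤· m 0≤x)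

·-monoˡ-≤ : ∀ {m n x} → 0ℚ ℚ.≤ x → m ℕ.≤ n → m · x ℚ.≤ n · x
·-monoˡ-≤ {n = n} 0≤x z≤n       = 0≤· n 0≤x
·-monoˡ-≤ {x = x} 0≤x (s≤s m≤n) = ℚ.+-monoʳ-≤ x (·-monoˡ-≤ 0≤x m≤n)

·-monoʳ-≤ : ∀ m {x y} → x ℚ.≤ y → m · x ℚ.≤ m · y
·-monoʳ-≤ zero    x≤y = ℚ.≤-refl
·-monoʳ-≤ (suc m) x≤y = ℚ.+-mono-≤ x≤y (·-monoʳ-≤ m x≤y)

∑-mono-≤ : ∀ {m} {f g : Fin m → ℚ} → (∀ i → f i ℚ.≤ g i) → ∑ f ℚ.≤ ∑ g
∑-mono-≤ {zero}  f≤g = ℚ.≤-refl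
∑-mono-≤ {suc m} f≤g = ℚ.+-mono-≤ (f≤g zero) (∑-mono-≤ (f≤g ∘ suc))

·-distrib-∑ : ∀ k {m} (f : Fin m → ℚ) → k · ∑ f ≡ ∑ (λ i → k · f i)
·-distrib-∑ k {m} f = trans (sym (sum-replicate k {∑ f}))
  (trans (∑-comm {k} {m} (λ _ → f)) (sum-cong-≗ {m} (λ i → sum-replicate k {f i})))

reciprocal : ∀ m .{{_ : ℕ.NonZero m}} → ∃ λ q → 0ℚ ℚ.< q × m · q ≡ 1ℚ
reciprocal m@(suc k) = 1/ x , ℚ.positive⁻¹ (1/ x) {{ℚ.1/pos⇒pos x}} , (begin
  m · 1/ x           ≡⟨ cong (m ·_) (ℚ.*-identityˡ (1/ x)) ⟨
  m · (1ℚ ℚ.* 1/ x)  ≡⟨ ×-assoc-* m 1ℚ (1/ x) ⟨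
  x ℚ.* 1/ x         ≡⟨ ℚ.*-inverseʳ x ⟩
  1ℚ                 ∎)
  where
  open ≡-Reasoning
  x : ℚ
  x = m · 1ℚ
  instance
    x-positive : ℚ.Positive x
    x-positive = ℚ.positive (ℚ.+-mono-<-≤ (ℚ.positive⁻¹ 1ℚ) (0≤· k (ℚ.<⇒≤ (ℚ.positive⁻¹ 1ℚ))))
    x-nonZero : ℚ.NonZero x
    x-nonZero = ℚ.pos⇒nonZero x

*-positive : ∀ {p q} → 0ℚ ℚ.< p → 0ℚ ℚ.< q → 0ℚ ℚ.< p ℚ.* q
*-positive {p} {q} 0<p 0<q =
  ℚ.positive⁻¹ (p ℚ.* q) {{ℚ.pos*pos⇒pos p {{ℚ.positive 0<p}} q {{ℚ.positive 0<q}}}}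

small : ∀ m {η} → 0ℚ ℚ.< η → ∃ λ δ → 0ℚ ℚ.< δ × m · δ ℚ.≤ η
-- Dividing by `suc m` keeps the divisor nonzero when `m` is `zero`.
small m {η} 0<η = scale (reciprocal (suc m))
  where
  scale : (∃ λ q → 0ℚ ℚ.< q × suc m · q ≡ 1ℚ) → ∃ λ δ → 0ℚ ℚ.< δ × m · δ ℚ.≤ η
  scale (q , 0<q , eq) = q ℚ.* η , 0<δ ,
    ℚ.≤-trans (·-monoˡ-≤ {x = q ℚ.* η} (ℚ.<⇒≤ 0<δ) (ℕ.n≤1+n m))
      (ℚ.≤-reflexive (trans (sym (×-assoc-* (suc m) q η))
        (trans (cong (ℚ._* η) eq) (ℚ.*-identityˡ η))))
    where
    0<δ : 0ℚ ℚ.< q ℚ.* η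
    0<δ = *-positive 0<q 0<η

∑-indicator : ∀ {m} (j : Fin m) (b : Fin m → ℚ) →
  ∑ (λ i → if does (j Fin.≟ i) then b i else 0ℚ) ≡ b j
∑-indicator {suc m} zero    b = trans (cong (b zero ℚ.+_) (sum-replicate-zero m)) (ℚ.+-identityʳ _)
∑-indicator {suc m} (suc j) b = trans (ℚ.+-identityˡ _) (∑-indicator j (b ∘ suc))

count-· : {A : Set} {P : A → Set} (P? : Unary.Decidable P) (x : ℚ) (xs : List A) →
  ∑ (λ j → if does (P? (lookup xs j)) then x else 0ℚ) ≡ count P? xs · x
count-· P? x []       = refl
count-· P? x (y ∷ ys) with P? y
... | yes _ = cong (x ℚ.+_) (count-· P? x ys)
... | no  _ = trans (ℚ.+-identityˡ _) (count-· P? x ys)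

-- Double counting: grouped by value, the sum over `xs` is the sum of `b i` times the number of
-- entries with value `i`. Since `b i` is nonnegative, the frequency bound may be multiplied by it.
sum-by-value : {A : Set} {m : ℕ} (K : ℕ) (value : A → Fin m) (xs : List A) →
  (∀ i → length xs ℕ.≤ K ℕ.* count (λ x → value x Fin.≟ i) xs) →
  (b : Fin m → ℚ) → (∀ i → 0ℚ ℚ.≤ b i) →
  length xs · ∑ b ℚ.≤ K · ∑ (λ j → b (value (lookup xs j)))
sum-by-value {m = m} K value xs frequent b 0≤b = begin
  length xs · ∑ b                 ≡⟨ ·-distrib-∑ (length xs) b ⟩
  ∑ (λ i → length xs · b i)       ≤⟨ ∑-mono-≤ (λ i → ·-monoˡ-≤ (0≤b i) (frequent i)) ⟩
  ∑ (λ i → (K ℕ.* c i) · b i)     ≡⟨ sum-cong-≗ (λ i → ×-assocˡ (b i) K (c i)) ⟨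
  ∑ (λ i → K · (c i · b i))       ≡⟨ ·-distrib-∑ K (λ i → c i · b i) ⟨
  K · ∑ (λ i → c i · b i)         ≡⟨ cong (K ·_) (sum-cong-≗ λ i → count-· (value≟ i) (b i) xs) ⟨
  K · ∑ (λ i → ∑ λ j → δ i j)     ≡⟨ cong (K ·_) (∑-comm δ) ⟩
  K · ∑ (λ j → ∑ λ i → δ i j)     ≡⟨ cong (K ·_) (sum-cong-≗ λ j → ∑-indicator (value (lookup xs j)) b) ⟩
  K · ∑ (λ j → b (value (lookup xs j))) ∎
  where
  open ℚ.≤-Reasoning
  value≟ : ∀ i → Unary.Decidable (λ x → value x ≡ i)
  value≟ i x = value x Fin.≟ i
  c : Fin m → ℕ
  c i = count (value≟ i) xs
  δ : Fin m → Fin (length xs) → ℚ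
  δ i j = if does (value≟ i (lookup xs j)) then b i else 0ℚ

-- Eventual statements about Cauchy sequences

Eventually : (ℕ → Set) → Set
Eventually P = ∃ λ N → ∀ k → N ℕ.≤ k → P k

eventually-both : ∀ {P Q} → Eventually P → Eventually Q → Eventually (λ k → P k × Q k)
eventually-both (M , p) (N , q) = M ℕ.⊔ N , λ k ≤k →
  p k (ℕ.m⊔n≤o⇒m≤o M N ≤k) , q k (ℕ.m⊔n≤o⇒n≤o M N ≤k)

eventually-all : ∀ {m} {P : Fin m → ℕ → Set} →
  (∀ i → Eventually (P i)) → Eventually (λ k → ∀ i → P i k)
eventually-all {zero}  p = 0 , λ _ _ ()
eventually-all {suc m} p
  with N , q ← eventually-both (p zero) (eventually-all (p ∘ suc)) = N , λ where
    k N≤k zero    → proj₁ (q k N≤k)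
    k N≤k (suc i) → proj₂ (q k N≤k) i

half-positive : ∀ {η} → 0ℚ ℚ.< η → 0ℚ ℚ.< η ℚ.* ½
half-positive 0<η = *-positive 0<η (ℚ.positive⁻¹ ½)

half+half : ∀ η → η ℚ.* ½ ℚ.+ η ℚ.* ½ ≡ η
half+half η = trans (sym (ℚ.*-distribˡ-+ η ½ ½)) (ℚ.*-identityʳ η)

+-cancelʳ-≤ : ∀ r {p q} → p ℚ.+ r ℚ.≤ q ℚ.+ r → p ℚ.≤ q
+-cancelʳ-≤ r {p} {q} p+r≤q+r =
  ℚ.≤-trans (ℚ.≤-reflexive (drop p r))
    (ℚ.≤-trans (ℚ.+-monoˡ-≤ (ℚ.- r) p+r≤q+r) (ℚ.≤-reflexive (sym (drop q r))))
  where
  open +-*-Solver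
  drop : ∀ p r → p ≡ (p ℚ.+ r) ℚ.- r
  drop = solve 2 (λ p r → p := (p :+ r) :- r) refl

p≤∣p∣ : ∀ p → p ℚ.≤ ℚ.∣ p ∣
p≤∣p∣ p with ℚ.≤-total 0ℚ p
... | inj₁ 0≤p = ℚ.≤-reflexive (sym (ℚ.0≤p⇒∣p∣≡p 0≤p))
... | inj₂ p≤0 = ℚ.≤-trans p≤0 (ℚ.0≤∣p∣ p)

∣p-q∣≤e⇒p≤q+e : ∀ p q {e} → ℚ.∣ p ℚ.- q ∣ ℚ.≤ e → p ℚ.≤ q ℚ.+ e
∣p-q∣≤e⇒p≤q+e p q {e} close = begin
  p                  ≡⟨ split p q ⟩
  q ℚ.+ (p ℚ.- q)    ≤⟨ ℚ.+-monoʳ-≤ q (p≤∣p∣ (p ℚ.- q)) ⟩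
  q ℚ.+ ℚ.∣ p ℚ.- q ∣  ≤⟨ ℚ.+-monoʳ-≤ q close ⟩
  q ℚ.+ e            ∎
  where
  open ℚ.≤-Reasoning
  split : ∀ p q → p ≡ q ℚ.+ (p ℚ.- q)
  split = solve 2 (λ p q → p := q :+ (p :- q)) refl
    where open +-*-Solver

-- If x ≤ y + η fails at an index past which both sequences move by at most
-- η / 4, then y + η / 2 ≤ x from that index on.
<-or-≥ : ExcludedMiddle 0ℓ → ∀ x y → y < x ⊎ x ≤ y
<-or-≥ em x y with em {y < x}
... | yes y<x = inj₁ y<x
... | no  y≮x = inj₂ bound
  where
  bound : x ≤ y
  bound η 0<η
    with M , closeˣ ← cauchy x (η ℚ.* ½ ℚ.* ½) (half-positive (half-positive 0<η))
    with N , closeʸ ← cauchy y (η ℚ.* ½ ℚ.* ½) (half-positive (half-positive 0<η))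
    = M ℕ.⊔ N , at
    where
    e : ℚ
    e = η ℚ.* ½ ℚ.* ½
    at : ∀ k → M ℕ.⊔ N ℕ.≤ k → seq x k ℚ.≤ seq y k ℚ.+ η
    at k ≤k with seq x k ℚ.≤? seq y k ℚ.+ η
    ... | yes x≤y = x≤y
    ... | no  x≰y = contradiction (η ℚ.* ½ , half-positive 0<η , M ℕ.⊔ N , gap) y≮x
      where
      open ℚ.≤-Reasoning
      gap : ∀ l → M ℕ.⊔ N ℕ.≤ l → seq y l ℚ.+ η ℚ.* ½ ℚ.≤ seq x l
      gap l ≤l = +-cancelʳ-≤ e (begin
        seq y l ℚ.+ η ℚ.* ½ ℚ.+ e          ≤⟨ ℚ.+-monoˡ-≤ e (ℚ.+-monoˡ-≤ (η ℚ.* ½)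
                                                (∣p-q∣≤e⇒p≤q+e (seq y l) (seq y k)
                                                (closeʸ l k (ℕ.m⊔n≤o⇒n≤o M N ≤l) (ℕ.m⊔n≤o⇒n≤o M N ≤k)))) ⟩
        seq y k ℚ.+ e ℚ.+ η ℚ.* ½ ℚ.+ e    ≡⟨ collect (seq y k) e (η ℚ.* ½) ⟩
        seq y k ℚ.+ (η ℚ.* ½ ℚ.+ (e ℚ.+ e)) ≡⟨ cong (λ h → seq y k ℚ.+ (η ℚ.* ½ ℚ.+ h)) (half+half (η ℚ.* ½)) ⟩
        seq y k ℚ.+ (η ℚ.* ½ ℚ.+ η ℚ.* ½)  ≡⟨ cong (seq y k ℚ.+_) (half+half η) ⟩
        seq y k ℚ.+ η                      ≤⟨ ℚ.<⇒≤ (ℚ.≰⇒> x≰y) ⟩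
        seq x k                            ≤⟨ ∣p-q∣≤e⇒p≤q+e (seq x k) (seq x l)
                                                (closeˣ k l (ℕ.m⊔n≤o⇒m≤o M N ≤k) (ℕ.m⊔n≤o⇒m≤o M N ≤l)) ⟩
        seq x l ℚ.+ e                      ∎)
        where
        collect : ∀ y e h → y ℚ.+ e ℚ.+ h ℚ.+ e ≡ y ℚ.+ (h ℚ.+ (e ℚ.+ e))
        collect = solve 3 (λ y e h → y :+ e :+ h :+ e := y :+ (h :+ (e :+ e))) refl
          where open +-*-Solver

-- One strict summand makes the whole sum strict: `η` is the gap at index `zero`, which exists as
-- `m` is nonzero, and the other indices supply weak bounds.
∑-below : ∀ {m} .{{_ : ℕ.NonZero m}} (g : Fin m → ℝ) y → (∀ j → g j < y) →
  ∃ λ η → 0ℚ ℚ.< η × Eventually (λ k → ∑ (λ j → seq (g j) k) ℚ.+ η ℚ.≤ m · seq y k)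
∑-below {suc m} g y below
  with η , 0<η , gap ← below zero
  with N , bound ← eventually-both gap (eventually-all λ j →
         let ηⱼ , 0<ηⱼ , M , gapⱼ = below (suc j) in
         M , λ k M≤k → ℚ.≤-trans
           (ℚ.≤-trans (ℚ.≤-reflexive (sym (ℚ.+-identityʳ _))) (ℚ.+-monoʳ-≤ (seq (g (suc j)) k) (ℚ.<⇒≤ 0<ηⱼ)))
           (gapⱼ k M≤k))
  = η , 0<η , N , λ k N≤k → let gap₀ , gaps = bound k N≤k in begin
    seq (g zero) k ℚ.+ ∑ (λ j → seq (g (suc j)) k) ℚ.+ η
      ≡⟨ rearrange (seq (g zero) k) (∑ (λ j → seq (g (suc j)) k)) η ⟩
    seq (g zero) k ℚ.+ η ℚ.+ ∑ (λ j → seq (g (suc j)) k)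
      ≤⟨ ℚ.+-mono-≤ gap₀ (∑-mono-≤ gaps) ⟩
    seq y k ℚ.+ ∑ {m} (λ _ → seq y k)
      ≡⟨ cong (seq y k ℚ.+_) (sum-replicate m) ⟩
    seq y k ℚ.+ m · seq y k ∎
  where
  open ℚ.≤-Reasoning
  rearrange : ∀ a b c → a ℚ.+ b ℚ.+ c ≡ a ℚ.+ c ℚ.+ b
  rearrange = solve 3 (λ a b c → a :+ b :+ c := a :+ c :+ b) refl
    where open +-*-Solver

-- If no `g j` reached `y`, all would lie strictly below it, and their sum would eventually stay a
-- fixed `η` below `m · y`; the hypothesis at `η / 2` excludes this.
average-attained : ExcludedMiddle 0ℓ → ∀ {m} .{{_ : ℕ.NonZero m}} (g : Fin m → ℝ) y →
  (∀ η → 0ℚ ℚ.< η → Eventually (λ k → m · seq y k ℚ.≤ ∑ (λ j → seq (g j) k) ℚ.+ η)) →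
  ∃ λ j → y ≤ g j
average-attained em {m} g y average with em {∃ λ j → y ≤ g j}
... | yes found = found
... | no  none
  with η , 0<η , below ← ∑-below g y (λ j →
         [ id , (λ y≤g → contradiction (j , y≤g) none) ] (<-or-≥ em y (g j)))
  with k , bounds ← eventually-both below (average (η ℚ.* ½) (half-positive 0<η))
  with upper , lower ← bounds k ℕ.≤-refl
  = contradiction
      (ℚ.<-≤-trans (ℚ.+-monoʳ-< (∑ (λ j → seq (g j) k)) half<) (ℚ.≤-trans upper lower))
      (ℚ.<-irrefl refl)
  where
  half< : η ℚ.* ½ ℚ.< η
  half< = subst (η ℚ.* ½ ℚ.<_) (half+half η)
    (subst (ℚ._< η ℚ.* ½ ℚ.+ η ℚ.* ½) (ℚ.+-identityʳ (η ℚ.* ½))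
      (ℚ.+-monoʳ-< (η ℚ.* ½) (half-positive 0<η)))

-- Sums of reals, one sequence index at a time

seq-sum-tabulate : ∀ {m} (f : Fin m → ℝ) k → seq (sum (tabulate f)) k ≡ ∑ (λ i → seq (f i) k)
seq-sum-tabulate {zero}  f k = refl
seq-sum-tabulate {suc m} f k = cong (seq (f zero) k ℚ.+_) (seq-sum-tabulate (f ∘ suc) k)

seq-sum-allFin : ∀ {m} (f : Fin m → ℝ) k → seq (sum (map f (allFin m))) k ≡ ∑ (λ i → seq (f i) k)
seq-sum-allFin f k = trans (cong (λ xs → seq (sum xs) k) (map-tabulate id f)) (seq-sum-tabulate f k)

mapWith∈-tabulate : {A B : Set} (xs : List A) (f : ∀ {x} → x ∈ xs → B) →
  mapWith∈ xs f ≡ tabulate (λ i → f (∈-lookup {xs = xs} i))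
mapWith∈-tabulate []       f = refl
mapWith∈-tabulate (x ∷ xs) f = cong (f _ ∷_) (mapWith∈-tabulate xs (λ x∈ → f (there x∈)))

module _ {A : Set} (xs : List A) {m : ℕ} (eq : m ≡ length xs) where

  -- The cast lets the colour lists of all vertices share the index type `Fin m`, so that an
  -- assignment of positions is a plain function.
  lookup′ : Fin m → A
  lookup′ i = lookup xs (cast eq i)

  ∈-lookup′ : ∀ i → lookup′ i ∈ xs
  ∈-lookup′ i = ∈-lookup (cast eq i)

  lookup′-injective : Unique xs → ∀ {i j} → lookup′ i ≡ lookup′ j → i ≡ j
  lookup′-injective unique {i} {j} same = Fin.toℕ-injective (trans (sym (Fin.toℕ-cast eq i))
    (trans (cong Fin.toℕ (lookup-injective unique (cast eq i) (cast eq j) same)) (Fin.toℕ-cast eq j)))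

seq-sum-mapWith∈ : {A : Set} (xs : List A) {m : ℕ} (eq : m ≡ length xs) (f : ∀ {x} → x ∈ xs → ℝ) (k : ℕ) →
  seq (sum (mapWith∈ xs f)) k ≡ ∑ (λ i → seq (f (∈-lookup′ xs eq i)) k)
seq-sum-mapWith∈ xs refl f k = trans (cong (λ ys → seq (sum ys) k) (mapWith∈-tabulate xs f))
  (trans (seq-sum-tabulate (λ i → f (∈-lookup {xs = xs} i)) k)
    (sum-cong-≗ λ i → cong (λ j → seq (f (∈-lookup {xs = xs} j)) k) (sym (Fin.cast-is-id refl i))))

-- Applied at one index k of the Cauchy sequences: a stands for
-- the weights at k, which are nonnegative only up to an error δ.
average-weight : ∀ {n m} K ε → 0ℚ ℚ.≤ ε → K · ε ≡ 1ℚ →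
  (Ω : List (Fin n → Fin m)) →
  (∀ v i → length Ω ℕ.≤ K ℕ.* count (λ φ → φ v Fin.≟ i) Ω) →
  (a : Fin n → Fin m → ℚ) → ∀ {δ} → 0ℚ ℚ.≤ δ → (∀ v i → 0ℚ ℚ.≤ a v i ℚ.+ δ) →
  length Ω · (ε ℚ.* ∑ λ v → ∑ (a v)) ℚ.≤
  ∑ (λ j → ∑ λ v → a v (lookup Ω j v)) ℚ.+ (length Ω ℕ.* n) · δ
average-weight {n} {m} K ε 0≤ε Kε≡1 Ω frequent a {δ} 0≤δ almost = begin
  M · (ε ℚ.* ∑ λ v → ∑ (a v))         ≡⟨ ×-comm-* M ε _ ⟨
  ε ℚ.* M · ∑ (λ v → ∑ (a v))         ≤⟨ ε-mono (·-monoʳ-≤ M (∑-mono-≤ λ v → ∑-mono-≤ λ i →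
                                         ℚ.p≤p⊔q (a v i) 0ℚ)) ⟩
  ε ℚ.* M · ∑ (λ v → ∑ (b v))         ≡⟨ cong (ε ℚ.*_) (·-distrib-∑ M (λ v → ∑ (b v))) ⟩
  ε ℚ.* ∑ (λ v → M · ∑ (b v))         ≤⟨ ε-mono (∑-mono-≤ λ v →
                                         sum-by-value K (λ φ → φ v) Ω (frequent v) (b v) (0≤b v)) ⟩
  ε ℚ.* ∑ (λ v → K · ∑ (λ j → b v (lookup Ω j v)))
                                      ≡⟨ cong (ε ℚ.*_) (·-distrib-∑ K λ v → ∑ λ j → b v (lookup Ω j v)) ⟨
  ε ℚ.* K · ∑ (λ v → ∑ (λ j → b v (lookup Ω j v)))
                                      ≡⟨ cong (λ x → ε ℚ.* K · x) (∑-comm λ v j → b v (lookup Ω j v)) ⟩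
  ε ℚ.* K · total                     ≡⟨ ×-comm-* K ε total ⟩
  K · (ε ℚ.* total)                   ≡⟨ ×-assoc-* K ε total ⟨
  K · ε ℚ.* total                     ≡⟨ cong (ℚ._* total) Kε≡1 ⟩
  1ℚ ℚ.* total                        ≡⟨ ℚ.*-identityˡ total ⟩
  total                               ≤⟨ ∑-mono-≤ (λ j → ∑-mono-≤ λ v → b≤a+δ v (lookup Ω j v)) ⟩
  ∑ (λ j → ∑ λ v → a v (lookup Ω j v) ℚ.+ δ)
                                      ≡⟨ sum-cong-≗ (λ j → ∑-distrib-+ (λ v → a v (lookup Ω j v)) (λ _ → δ)) ⟩
  ∑ (λ j → ∑ (λ v → a v (lookup Ω j v)) ℚ.+ ∑ {n} (λ _ → δ))
                                      ≡⟨ ∑-distrib-+ (λ j → ∑ (λ v → a v (lookup Ω j v))) (λ _ → ∑ {n} (λ _ → δ)) ⟩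
  S ℚ.+ ∑ {M} (λ _ → ∑ {n} (λ _ → δ)) ≡⟨ cong (S ℚ.+_) (trans (sum-replicate M)
                                         (trans (cong (M ·_) (sum-replicate n)) (×-assocˡ δ M n))) ⟩
  S ℚ.+ (M ℕ.* n) · δ                 ∎
  where
  open ℚ.≤-Reasoning
  M : ℕ
  M = length Ω
  -- `sum-by-value` needs nonnegative values, so `a` is truncated at zero. This raises each entry by
  -- at most `δ`, and `M * n` entries occur in the sum over the outcomes.
  b : Fin n → Fin m → ℚ
  b v i = a v i ℚ.⊔ 0ℚ
  S total : ℚ
  S = ∑ λ j → ∑ λ v → a v (lookup Ω j v)
  total = ∑ λ j → ∑ λ v → b v (lookup Ω j v)
  0≤b : ∀ v i → 0ℚ ℚ.≤ b v i
  0≤b v i = ℚ.p≤q⊔p (a v i) 0ℚ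
  b≤a+δ : ∀ v i → b v i ℚ.≤ a v i ℚ.+ δ
  b≤a+δ v i = ℚ.⊔-lub
    (ℚ.≤-trans (ℚ.≤-reflexive (sym (ℚ.+-identityʳ (a v i)))) (ℚ.+-monoʳ-≤ (a v i) 0≤δ))
    (almost v i)
  ε-mono : ∀ {p q} → p ℚ.≤ q → ε ℚ.* p ℚ.≤ ε ℚ.* q
  ε-mono = ℚ.*-monoˡ-≤-nonNeg ε {{ℚ.nonNegative 0≤ε}}

-- Flexibility of degenerate graphs

module _ (em : ExcludedMiddle 0ℓ) {d : ℕ} {G : Graph} (degenerate : Degenerate d G)
  {C : Set} (L : ListAssignment G C)
  (lengths : ∀ v → 2 ℕ.+ d ≡ length (ListAssignment.colors L v)) where
  open Graph G
  open ListAssignment L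

  private
    κ : V → Fin (2 ℕ.+ d) → C
    κ v = lookup′ (colors v) (lengths v)

    -- Equality in an arbitrary `C` has no decision procedure, so conflicts are decided by excluded
    -- middle. Injectivity holds because a colour occurs only once in the list of `u`.
    open Greedy _~?_ {λ v i u j → v ~ u × κ v i ≡ κ u j} (λ _ _ _ _ → em) proj₁
      (λ (v~u , eq) → ~-sym v~u , sym eq)
      (λ (v~v , _) → ~-irrefl _ v~v)
      (λ {_} {_} {u} (_ , eq) (_ , eq′) →
        lookup′-injective (colors u) (lengths u) (unique u) (trans (sym eq) eq′))

    vs : List V
    vs = proj₁ (ordering G degenerate)

    o : Ordering _~?_ d vs
    o = proj₁ (proj₂ (ordering G degenerate))

    ∈vs : ∀ v → v ∈ vs
    ∈vs = proj₂ (proj₂ (ordering G degenerate))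

    Ω : List Assignment
    Ω = outcomes o

    coloring : Fin (length Ω) → Coloring L
    coloring j = record
      { color  = λ v → κ v (lookup Ω j v)
      ; proper = λ u~v eq → outcomes-proper o (∈-lookup j) (∈vs _) (∈vs _) (u~v , eq)
      ; listed = λ v → ∈-lookup′ (colors v) (lengths v) (lookup Ω j v)
      }

  -- The averaging inequality is shown at each large index `k` up to any error `η`;
  -- `average-attained` then yields a single outcome, independent of `k`.
  flexible : ∀ {ε} → 0ℚ ℚ.< ε → (D ℕ.^ suc d) · ε ≡ 1ℚ → WeightedFlexible L (fromℚ ε)
  flexible {ε} 0<ε Kε≡1 w =
    let j , satisfied = average-attained em {{ℕ.>-nonZero (outcomes-nonempty o)}}
                          (λ j → coloringWeight L w (coloring j)) (fromℚ ε * totalWeight L w) average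
    in coloring j , satisfied
    where
    open WeightedRequest w
    open ℚ.≤-Reasoning

    a : ℕ → V → Fin (2 ℕ.+ d) → ℚ
    a k v i = seq (weight v (∈-lookup′ (colors v) (lengths v) i)) k

    total : ∀ k → seq (totalWeight L w) k ≡ ∑ λ v → ∑ (a k v)
    total k = trans (seq-sum-allFin (λ v → sum (mapWith∈ (colors v) (weight v))) k)
      (sum-cong-≗ λ v → seq-sum-mapWith∈ (colors v) (lengths v) (weight v) k)

    attained : ∀ k → ∑ (λ j → seq (coloringWeight L w (coloring j)) k) ≡
                     ∑ λ j → ∑ λ v → a k v (lookup Ω j v)
    attained k = sum-cong-≗ λ j → seq-sum-allFin (λ v → weight v (Coloring.listed (coloring j) v)) k

    average : ∀ η → 0ℚ ℚ.< η → Eventually λ k →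
      length Ω · (ε ℚ.* seq (totalWeight L w) k) ℚ.≤
      ∑ (λ j → seq (coloringWeight L w (coloring j)) k) ℚ.+ η
    average η 0<η = bound (small (length Ω ℕ.* order) 0<η)
      where
      bound : (∃ λ δ → 0ℚ ℚ.< δ × (length Ω ℕ.* order) · δ ℚ.≤ η) → _
      bound (δ , 0<δ , δ≤η) =
        -- A nonnegative real has a sequence that is only eventually at least `- δ`; finitely many
        -- weights have a common threshold `N`.
        let N , almost = eventually-all λ v → eventually-all λ i →
              nonneg v (∈-lookup′ (colors v) (lengths v) i) δ 0<δ
        in N , λ k N≤k → begin
          length Ω · (ε ℚ.* seq (totalWeight L w) k)
            ≡⟨ cong (λ t → length Ω · (ε ℚ.* t)) (total k) ⟩
          length Ω · (ε ℚ.* ∑ λ v → ∑ (a k v))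
            ≤⟨ average-weight (D ℕ.^ suc d) ε (ℚ.<⇒≤ 0<ε) Kε≡1 Ω
                 (λ v → count-value o (∈vs v)) (a k) (ℚ.<⇒≤ 0<δ) (almost k N≤k) ⟩
          ∑ (λ j → ∑ λ v → a k v (lookup Ω j v)) ℚ.+ (length Ω ℕ.* order) · δ
            ≤⟨ ℚ.+-monoʳ-≤ (∑ λ j → ∑ λ v → a k v (lookup Ω j v)) δ≤η ⟩
          ∑ (λ j → ∑ λ v → a k v (lookup Ω j v)) ℚ.+ η
            ≡⟨ cong (ℚ._+ η) (attained k) ⟨
          ∑ (λ j → seq (coloringWeight L w (coloring j)) k) ℚ.+ η ∎

theorem2 : ExcludedMiddle 0ℓ →
  ∀ (d : ℕ) → ∃ λ (ε : ℝ) → 0ℝ < ε ×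
    ((G : Graph) → Degenerate d G →
     (C : Set) (L : ListAssignment G C) →
     (∀ v → length (ListAssignment.colors L v) ≡ d ℕ.+ 2) →
     WeightedFlexible L ε)
theorem2 em d =
  -- `ε` is `(d + 2) ^ - (d + 1)`. The form `2 + d` exposes the two successors that the pigeonhole
  -- argument uses.
  let ε , 0<ε , Kε≡1 = reciprocal ((2 ℕ.+ d) ℕ.^ suc d) {{ℕ.m^n≢0 (2 ℕ.+ d) (suc d)}} in
  fromℚ ε , (ε , 0<ε , 0 , λ _ _ → ℚ.≤-reflexive (ℚ.+-identityˡ ε)) ,
  λ G degenerate C L lengths →
    flexible em degenerate L (λ v → trans (ℕ.+-comm 2 d) (sym (lengths v))) 0<ε Kε≡1
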